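{- Let $a,b,c$ be positive real numbers and let $\{g_{n}^{(3)}(a,b,c;1)\}_{n\ge 0}$ be the geometric mean sequence defined by $g_{0}^{(3)}=a$, $g_{1}^{(3)}=b$, $g_{2}^{(3)}=c$ and $g_{n+3}^{(3)}=\sqrt[3]{g_{n+2}^{(3)}g_{n+1}^{(3)}g_{n}^{(3)}}$ for $n\ge 0$. Let $\{T_{n}^{(3)}\}_{n\ge 0}$ be the integer sequence defined by $T_{0}^{(3)}=T_{1}^{(3)}=0$, $T_{2}^{(3)}=1$ and $T_{n+3}^{(3)}=T_{n+2}^{(3)}+3T_{n+1}^{(3)}+9T_{n}^{(3)}$ for $n\ge 0$. Then for all $n\ge 0$, $$g_{n+2}^{(3)}(a,b,c;1)=\left(a^{T_{n+1}^{(3)}}\,b^{T_{n+1}^{(3)}+3T_{n}^{(3)}}\,c^{T_{n+2}^{(3)}}\right)^{3^{ -n}}.$$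
   Context: Cube roots and the fractional power $(\cdot)^{3^{ -n}}$ denote the positive real roots of positive real numbers. The superscript $(3)$ is part of the notation for the sequences, not an exponent. The last argument $1$ in $g_n^{(3)}(a,b,c;1)$ indicates that the scaling constant multiplying the cube root in the recurrence equals $1$. -}

module Defs where

open import Data.Integer.Base as ℤ using (+_; -[1+_])
import Data.Integer.Properties as ℤ
open import Data.Nat.Base as ℕ using (ℕ; zero; suc)
open import Data.Nat.Properties using (m^n≢0)
open import Data.Product.Base using (∃; ∃₂; _×_; _,_)
open import Data.Rational.Base
  using (ℚ; mkℚ; 0ℚ; 1ℚ; _+_; _*_; _-_; -_; 1/_; _<_; _≤_; *<*; toℚᵘ; NonZero; positive; nonNegative)
open import Data.Rational.Properties
open import Data.Rational.Solver using (module +-*-Solver)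
import Data.Rational.Unnormalised.Base as ℚᵘ
import Data.Rational.Unnormalised.Properties as ℚᵘ
open import Data.Sum.Base using (_⊎_; inj₁; inj₂; [_,_]′)
open import Relation.Binary.PropositionalEquality
  using (_≡_; refl; sym; trans; cong; subst; subst₂)
open import Relation.Nullary.Decidable.Core using (Dec; yes; no)
open import Relation.Nullary.Negation.Core using (¬_; contradiction)
open import Relation.Unary using (Pred; _∈_)
open import Level using (0ℓ)

private
  variable
    p q r s t : ℚ

0<1 : 0ℚ < 1ℚ
0<1 = positive⁻¹ 1ℚ

*-pos : 0ℚ < p → 0ℚ < q → 0ℚ < p * q
*-pos {p} {q} 0<p 0<q =
  positive⁻¹ (p * q) {{pos*pos⇒pos p {{positive 0<p}} q {{positive 0<q}}}}

*-mono-≤ : 0ℚ < q → 0ℚ < r → p ≤ q → r ≤ s → p * r ≤ q * s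
*-mono-≤ {q} {r} 0<q 0<r p≤q r≤s = ≤-trans
  (*-monoʳ-≤-nonNeg r {{nonNegative (<⇒≤ 0<r)}} p≤q)
  (*-monoˡ-≤-nonNeg q {{nonNegative (<⇒≤ 0<q)}} r≤s)

*-mono-<-≤ : 0ℚ < q → 0ℚ < r → p < q → r ≤ s → p * r < q * s
*-mono-<-≤ {q} {r} 0<q 0<r p<q r≤s = <-≤-trans
  (*-monoˡ-<-pos r {{positive 0<r}} p<q)
  (*-monoˡ-≤-nonNeg q {{nonNegative (<⇒≤ 0<q)}} r≤s)

*-mono-≤-< : 0ℚ < q → 0ℚ < r → p ≤ q → r < s → p * r < q * s
*-mono-≤-< {q} {r} 0<q 0<r p≤q r<s = ≤-<-trans
  (*-monoʳ-≤-nonNeg r {{nonNegative (<⇒≤ 0<r)}} p≤q)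
  (*-monoʳ-<-pos q {{positive 0<q}} r<s)

*-cancelˡ-< : 0ℚ < r → r * p < r * q → p < q
*-cancelˡ-< {r} 0<r = *-cancelˡ-<-nonNeg r {{nonNegative (<⇒≤ 0<r)}}

*-cancelˡ-≤ : 0ℚ < r → r * p ≤ r * q → p ≤ q
*-cancelˡ-≤ {r} 0<r = *-cancelˡ-≤-pos r {{positive 0<r}}

pos-factor : 0ℚ < r → 0ℚ < r * p → 0ℚ < p
pos-factor {r} {p} 0<r 0<rp =
  *-cancelˡ-< 0<r (subst (_< r * p) (sym (*-zeroʳ r)) 0<rp)

divide : 0ℚ < r → ∀ s → ∃ λ t → r * t ≡ s
divide {r} 0<r s = i * s , trans (sym (*-assoc r i s))
  (trans (cong (_* s) (*-inverseʳ r {{nz}})) (*-identityˡ s))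
  where
  nz : NonZero r
  nz = pos⇒nonZero r {{positive 0<r}}
  i : ℚ
  i = (1/ r) {{nz}}

enlarge : 0ℚ < r → r * p < s → ∃ λ q → p < q × r * q < s
enlarge {r} {p} {s} 0<r rp<s with t , rt≡s ← divide 0<r s
  with q , p<q , q<t ← <-dense (*-cancelˡ-< {r} {p} {t} 0<r (subst (r * p <_) (sym rt≡s) rp<s))
  = q , p<q , subst (r * q <_) rt≡s (*-monoʳ-<-pos r {{positive 0<r}} q<t)

shrink : 0ℚ < r → s < r * p → ∃ λ q → q < p × s < r * q
shrink {r} {s} {p} 0<r s<rp with t , rt≡s ← divide 0<r s
  with q , t<q , q<p ← <-dense (*-cancelˡ-< {r} {t} {p} 0<r (subst (_< r * p) (sym rt≡s) s<rp))
  = q , q<p , subst (_< r * q) rt≡s (*-monoʳ-<-pos r {{positive 0<r}} t<q)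

p<p+q : ∀ p → 0ℚ < q → p < p + q
p<p+q {q} p 0<q = subst (_< p + q) (+-identityʳ p) (+-monoʳ-< p 0<q)

p<q⇒0<q-p : p < q → 0ℚ < q - p
p<q⇒0<q-p {p} {q} p<q = subst (_< q - p) (+-inverseʳ p) (+-monoˡ-< (- p) p<q)

smaller : r < p → r < q → ∃ λ t → r < t × t ≤ p × t ≤ q
smaller {r} {p} {q} r<p r<q with ≤-total p q
... | inj₁ p≤q = p , r<p , ≤-refl , p≤q
... | inj₂ q≤p = q , r<q , q≤p , ≤-refl

larger : p < r → q < r → ∃ λ t → t < r × p ≤ t × q ≤ t
larger {p} {r} {q} p<r q<r with ≤-total p q
... | inj₁ p≤q = q , q<r , p≤q , ≤-refl
... | inj₂ q≤p = p , p<r , ≤-refl , q≤p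

infixr 8 _^ℚ_

_^ℚ_ : ℚ → ℕ → ℚ
p ^ℚ zero  = 1ℚ
p ^ℚ suc k = p * p ^ℚ k

^ℚ-pos : ∀ k → 0ℚ < p → 0ℚ < p ^ℚ k
^ℚ-pos zero    0<p = 0<1
^ℚ-pos (suc k) 0<p = *-pos 0<p (^ℚ-pos k 0<p)

^ℚ-mono-≤ : ∀ k → 0ℚ < p → p ≤ q → p ^ℚ k ≤ q ^ℚ k
^ℚ-mono-≤ zero    0<p p≤q = ≤-refl
^ℚ-mono-≤ (suc k) 0<p p≤q =
  *-mono-≤ (<-≤-trans 0<p p≤q) (^ℚ-pos k 0<p) p≤q (^ℚ-mono-≤ k 0<p p≤q)

^ℚ-mono-< : ∀ k .{{_ : ℕ.NonZero k}} → 0ℚ < p → p < q → p ^ℚ k < q ^ℚ k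
^ℚ-mono-< (suc k) 0<p p<q =
  *-mono-<-≤ (<-trans 0<p p<q) (^ℚ-pos k 0<p) p<q (^ℚ-mono-≤ k 0<p (<⇒≤ p<q))

1^ℚ : ∀ k → 1ℚ ^ℚ k ≡ 1ℚ
1^ℚ zero    = refl
1^ℚ (suc k) = trans (*-identityˡ (1ℚ ^ℚ k)) (1^ℚ k)

^ℚ-≤ : ∀ k .{{_ : ℕ.NonZero k}} → 0ℚ < p → p ≤ 1ℚ → p ^ℚ k ≤ p
^ℚ-≤ {p} (suc k) 0<p p≤1 = subst (p * p ^ℚ k ≤_) (*-identityʳ p)
  (*-mono-≤ 0<p (^ℚ-pos k 0<p) ≤-refl (subst (p ^ℚ k ≤_) (1^ℚ k) (^ℚ-mono-≤ k 0<p p≤1)))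

^ℚ-≥ : ∀ k .{{_ : ℕ.NonZero k}} → 1ℚ ≤ p → p ≤ p ^ℚ k
^ℚ-≥ {p} (suc k) 1≤p = subst (_≤ p * p ^ℚ k) (*-identityʳ p)
  (*-mono-≤ (<-≤-trans 0<1 1≤p) 0<1 ≤-refl (subst (_≤ p ^ℚ k) (1^ℚ k) (^ℚ-mono-≤ k 0<1 1≤p)))

^ℚ-enlarge : ∀ k → 0ℚ < p → p ^ℚ k < s → ∃ λ q → p < q × q ^ℚ k < s
^ℚ-enlarge {p} zero 0<p 1<s = p + 1ℚ , p<p+q p 0<1 , 1<s
^ℚ-enlarge {p} {s} (suc k) 0<p pᵏ⁺¹<s
  with m , pᵏ<m , pm<s ← enlarge {p} {p ^ℚ k} 0<p pᵏ⁺¹<s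
  with q₁ , p<q₁ , q₁ᵏ<m ← ^ℚ-enlarge k 0<p pᵏ<m
  with q₂ , p<q₂ , mq₂<s ← enlarge {m} {p} (<-trans (^ℚ-pos k 0<p) pᵏ<m)
                                   (subst (_< s) (*-comm p m) pm<s)
  with q , p<q , q≤q₁ , q≤q₂ ← smaller p<q₁ p<q₂
  = q , p<q , <-trans
      (*-mono-≤-< (<-trans 0<p p<q₂) (^ℚ-pos k 0<q) q≤q₂ (≤-<-trans (^ℚ-mono-≤ k 0<q q≤q₁) q₁ᵏ<m))
      (subst (_< s) (*-comm m q₂) mq₂<s)
  where
  0<q : 0ℚ < q
  0<q = <-trans 0<p p<q

^ℚ-shrink : ∀ k → 0ℚ < s → 0ℚ < p → s < p ^ℚ k → ∃ λ q → 0ℚ < q × q < p × s < q ^ℚ k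
^ℚ-shrink zero 0<s 0<p s<1 with q , 0<q , q<p ← <-dense 0<p = q , 0<q , q<p , s<1
^ℚ-shrink {s} {p} (suc k) 0<s 0<p s<pᵏ⁺¹
  with m , m<pᵏ , s<pm ← shrink {p} {s} {p ^ℚ k} 0<p s<pᵏ⁺¹
  with 0<m ← pos-factor {p} {m} 0<p (<-trans 0<s s<pm)
  with q₁ , 0<q₁ , q₁<p , m<q₁ᵏ ← ^ℚ-shrink k 0<m 0<p m<pᵏ
  with q₂ , q₂<p , s<mq₂ ← shrink {m} {s} {p} 0<m (subst (s <_) (*-comm p m) s<pm)
  with q , q<p , q₁≤q , q₂≤q ← larger q₁<p q₂<p
  = q , <-≤-trans 0<q₁ q₁≤q , q<p , <-trans
      (subst (s <_) (*-comm m q₂) s<mq₂)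
      (*-mono-≤-< (<-≤-trans 0<q₁ q₁≤q) 0<m q₂≤q
        (<-≤-trans m<q₁ᵏ (^ℚ-mono-≤ k 0<q₁ q₁≤q)))

fromℕ : ℕ → ℚ
fromℕ zero    = 0ℚ
fromℕ (suc n) = 1ℚ + fromℕ n

toℚᵘ-fromℕ : ∀ n → toℚᵘ (fromℕ n) ℚᵘ.≃ ℚᵘ.mkℚᵘ (+ n) 0
toℚᵘ-fromℕ zero    = ℚᵘ.≃-refl
toℚᵘ-fromℕ (suc n) = ℚᵘ.≃-trans (toℚᵘ-homo-+ 1ℚ (fromℕ n))
  (ℚᵘ.≃-trans (ℚᵘ.+-congʳ (toℚᵘ 1ℚ) (toℚᵘ-fromℕ n))
    (ℚᵘ.*≡* (cong (λ i → (+ 1 ℤ.+ i) ℤ.* + 1) (ℤ.*-identityʳ (+ n)))))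

+-fromℕ-zero : ∀ p s → p + fromℕ zero * s ≡ p
+-fromℕ-zero p s = trans (cong (λ z → p + z) (*-zeroˡ s)) (+-identityʳ p)

+-fromℕ-suc : ∀ p n s → p + fromℕ (suc n) * s ≡ (p + s) + fromℕ n * s
+-fromℕ-suc p n s =
  solve 3 (λ p m s → p :+ (con 1ℚ :+ m) :* s := (p :+ s) :+ m :* s) refl p (fromℕ n) s
  where open +-*-Solver

p≤fromℕ : ∀ p → ∃ λ n → p ≤ fromℕ n
p≤fromℕ p@(mkℚ i d _) = ℤ.∣ i ∣ , toℚᵘ-cancel-≤
  (ℚᵘ.≤-trans (ℚᵘ.*≤* (bound i)) (ℚᵘ.≤-reflexive (ℚᵘ.≃-sym (toℚᵘ-fromℕ ℤ.∣ i ∣))))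
  where
  bound : ∀ i → i ℤ.* + 1 ℤ.≤ + ℤ.∣ i ∣ ℤ.* + suc d
  bound (+ n)    = ℤ.*-monoˡ-≤-nonNeg (+ n) (ℤ.+≤+ (ℕ.s≤s ℕ.z≤n))
  bound -[1+ n ] = ℤ.≤-trans (ℤ.≤-reflexive (ℤ.*-identityʳ -[1+ n ])) ℤ.-≤+

archimedean : 0ℚ < r → ∀ p q → ∃ λ n → q ≤ p + fromℕ n * r
archimedean {r} 0<r p q with t , rt≡q-p ← divide 0<r (q - p)
  with n , t≤n ← p≤fromℕ t
  = n , subst (_≤ p + fromℕ n * r) eq
      (+-monoʳ-≤ p (*-monoʳ-≤-nonNeg r {{nonNegative (<⇒≤ 0<r)}} t≤n))
  where
  open +-*-Solver
  eq : p + t * r ≡ q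
  eq = trans (cong (λ z → p + z) (trans (*-comm t r) rt≡q-p))
    (solve 2 (λ p q → p :+ (q :- p) := q) refl p q)

-- Two-sided, located Dedekind cuts: q ∈ L means q < x, and q ∈ U means x < q.
record ℝ : Set₁ where
  field
    L U         : Pred ℚ 0ℓ
    L-inhabited : ∃ λ q → q ∈ L
    U-inhabited : ∃ λ q → q ∈ U
    L-closed    : q < r → r ∈ L → q ∈ L
    U-closed    : q < r → q ∈ U → r ∈ U
    L-open      : q ∈ L → ∃ λ r → q < r × r ∈ L
    U-open      : r ∈ U → ∃ λ q → q < r × q ∈ U
    disjoint    : q ∈ L → ¬ (q ∈ U)
    located     : q < r → q ∈ L ⊎ r ∈ U

  L-closed-≤ : q ≤ r → r ∈ L → q ∈ L
  L-closed-≤ q≤r r∈L with s , r<s , s∈L ← L-open r∈L = L-closed (≤-<-trans q≤r r<s) s∈L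

  U-closed-≤ : q ≤ r → q ∈ U → r ∈ U
  U-closed-≤ q≤r q∈U with s , s<q , s∈U ← U-open q∈U = U-closed (<-≤-trans s<q q≤r) s∈U

  L<U : q ∈ L → r ∈ U → q < r
  L<U {q} {r} q∈L r∈U with q <? r
  ... | yes q<r = q<r
  ... | no  q≮r = contradiction r∈U (disjoint (L-closed-≤ (≮⇒≥ q≮r) q∈L))

  approx : 0ℚ < s → ∀ n p → p ∈ L → p + fromℕ n * s ∈ U →
           ∃ λ l → p ≤ l × l ∈ L × l + (s + s) ∈ U
  approx {s} 0<s zero p p∈L end∈U =
    contradiction (subst (_∈ U) (+-fromℕ-zero p s) end∈U) (disjoint p∈L)
  approx {s} 0<s (suc n) p p∈L end∈U = [ step , stop ]′ (located (p<p+q (p + s) 0<s))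
    where
    Goal : Set
    Goal = ∃ λ l → p ≤ l × l ∈ L × l + (s + s) ∈ U
    step : p + s ∈ L → Goal
    step p+s∈L =
      let l , p+s≤l , rest = approx 0<s n (p + s) p+s∈L (subst (_∈ U) (+-fromℕ-suc p n s) end∈U)
      in l , ≤-trans (<⇒≤ (p<p+q p 0<s)) p+s≤l , rest
    stop : (p + s) + s ∈ U → Goal
    stop p+s+s∈U = p , ≤-refl , p∈L , subst (_∈ U) (+-assoc p s s) p+s+s∈U

infix 4 _≈ᴿ_

_≈ᴿ_ : ℝ → ℝ → Set
x ≈ᴿ y = ∀ q → ((q ∈ L x → q ∈ L y) × (q ∈ L y → q ∈ L x))
             × ((q ∈ U x → q ∈ U y) × (q ∈ U y → q ∈ U x))
  where open ℝ

fromℚ : ℚ → ℝ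
fromℚ p = record
  { L           = _< p
  ; U           = p <_
  ; L-inhabited = p - 1ℚ , subst (p - 1ℚ <_) (+-identityʳ p) (+-monoʳ-< p (*<* ℤ.-<+))
  ; U-inhabited = p + 1ℚ , p<p+q p 0<1
  ; L-closed    = <-trans
  ; U-closed    = λ q<r p<q → <-trans p<q q<r
  ; L-open      = <-dense
  ; U-open      = λ p<r → let q , p<q , q<r = <-dense p<r in q , q<r , p<q
  ; disjoint    = <-asym
  ; located     = loc
  }
  where
  loc : q < r → q < p ⊎ p < r
  loc {q} {r} q<r with q <? p
  ... | yes q<p = inj₁ q<p
  ... | no  q≮p = inj₂ (≤-<-trans (≮⇒≥ q≮p) q<r)

record ℝ⁺ : Set₁ where
  constructor _,⁺_
  field
    real : ℝ
    pos  : 0ℚ ∈ ℝ.L real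
  open ℝ real public

  L-pos : ∃ λ q → 0ℚ < q × q ∈ L
  L-pos = L-open pos

  U-pos : q ∈ U → 0ℚ < q
  U-pos = L<U pos

  approx-ratio : 0ℚ < q → q < r → ∃₂ λ l u → 0ℚ < l × l ∈ L × u ∈ U × u * q ≤ l * r
  approx-ratio {q} {r} 0<q q<r =
    let p , 0<p , p∈L = L-pos
        v , v∈U       = U-inhabited
        s , eq        = divide 0<q+q (p * (r - q))
        0<s           = pos-factor 0<q+q (subst (0ℚ <_) (sym eq) (*-pos 0<p 0<r-q))
        n , v≤end     = archimedean 0<s p v
        l , p≤l , l∈L , u∈U = approx 0<s n p p∈L (U-closed-≤ v≤end v∈U)
    in l , l + (s + s) , <-≤-trans 0<p p≤l , l∈L , u∈U , bound p≤l eq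
    where
    0<q+q : 0ℚ < q + q
    0<q+q = <-trans 0<q (p<p+q q 0<q)
    0<r-q : 0ℚ < r - q
    0<r-q = p<q⇒0<q-p q<r
    bound : ∀ {l p s} → p ≤ l → (q + q) * s ≡ p * (r - q) → (l + (s + s)) * q ≤ l * r
    bound {l} {p} {s} p≤l eq = begin
      (l + (s + s)) * q       ≡⟨ solve 3 (λ l s q → (l :+ (s :+ s)) :* q := l :* q :+ (q :+ q) :* s) refl l s q ⟩
      l * q + (q + q) * s     ≡⟨ cong (λ t → l * q + t) eq ⟩
      l * q + p * (r - q)     ≤⟨ +-monoʳ-≤ (l * q) (*-monoʳ-≤-nonNeg (r - q) {{nonNegative (<⇒≤ 0<r-q)}} p≤l) ⟩
      l * q + l * (r - q)     ≡⟨ solve 3 (λ l q r → l :* q :+ l :* (r :- q) := l :* r) refl l q r ⟩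
      l * r                   ∎
      where
      open ≤-Reasoning
      open +-*-Solver

infix 4 _≈_

_≈_ : ℝ⁺ → ℝ⁺ → Set
x ≈ y = ℝ⁺.real x ≈ᴿ ℝ⁺.real y

1⁺ : ℝ⁺
1⁺ = fromℚ 1ℚ ,⁺ 0<1

infixl 7 _·_

-- Positivity of both factors makes the product of cuts the set of products of
-- positive lower bounds (closed downwards) and of upper bounds (closed upwards).
_·_ : ℝ⁺ → ℝ⁺ → ℝ⁺
x · y = product ,⁺ 0∈L
  where
  module X = ℝ⁺ x
  module Y = ℝ⁺ y

  L′ U′ : Pred ℚ 0ℓ
  L′ q = ∃₂ λ r s → (0ℚ < r × r ∈ X.L) × (0ℚ < s × s ∈ Y.L) × q ≤ r * s
  U′ q = ∃₂ λ r s → r ∈ X.U × s ∈ Y.U × r * s ≤ q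

  0∈L : 0ℚ ∈ L′
  0∈L with r , 0<r , r∈L ← X.L-pos | s , 0<s , s∈L ← Y.L-pos
    = r , s , (0<r , r∈L) , (0<s , s∈L) , <⇒≤ (*-pos 0<r 0<s)

  inhabited : ∃ λ q → q ∈ U′
  inhabited with r , r∈U ← X.U-inhabited | s , s∈U ← Y.U-inhabited
    = r * s , r , s , r∈U , s∈U , ≤-refl

  open-L : q ∈ L′ → ∃ λ r → q < r × r ∈ L′
  open-L (r , s , (0<r , r∈L) , (0<s , s∈L) , q≤rs)
    with r′ , r<r′ , r′∈L ← X.L-open r∈L
    = r′ * s
    , ≤-<-trans q≤rs (*-monoˡ-<-pos s {{positive 0<s}} r<r′)
    , r′ , s , (<-trans 0<r r<r′ , r′∈L) , (0<s , s∈L) , ≤-refl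

  open-U : r ∈ U′ → ∃ λ q → q < r × q ∈ U′
  open-U (r , s , r∈U , s∈U , rs≤q)
    with r′ , r′<r , r′∈U ← X.U-open r∈U
    = r′ * s
    , <-≤-trans (*-monoˡ-<-pos s {{positive (Y.U-pos s∈U)}} r′<r) rs≤q
    , r′ , s , r′∈U , s∈U , ≤-refl

  disj : q ∈ L′ → ¬ (q ∈ U′)
  disj (r , s , (0<r , r∈L) , (0<s , s∈L) , q≤rs) (r′ , s′ , r′∈U , s′∈U , r′s′≤q) =
    <-irrefl refl (<-≤-trans
      (*-mono-<-≤ (X.U-pos r′∈U) 0<s (X.L<U r∈L r′∈U) (<⇒≤ (Y.L<U s∈L s′∈U)))
      (≤-trans r′s′≤q q≤rs))

  compare : ∀ {m l₁ u₁ l₂ u₂} → 0ℚ < q → q < m → m < r →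
            0ℚ < l₁ × l₁ ∈ X.L × u₁ ∈ X.U × u₁ * q ≤ l₁ * m →
            0ℚ < l₂ × l₂ ∈ Y.L × u₂ ∈ Y.U × u₂ * m ≤ l₂ * r →
            q ∈ L′ ⊎ r ∈ U′
  compare {q} {r} {m} {l₁} {u₁} {l₂} {u₂} 0<q q<m m<r
    (0<l₁ , l₁∈L , u₁∈U , u₁q≤l₁m) (0<l₂ , l₂∈L , u₂∈U , u₂m≤l₂r) = decide (q ≤? l₁ * l₂)
    where
    open +-*-Solver
    0<m : 0ℚ < m
    0<m = <-trans 0<q q<m
    bound : l₁ * l₂ < q → (q * m) * (u₁ * u₂) ≤ (q * m) * r
    bound l₁l₂<q = begin
      (q * m) * (u₁ * u₂) ≡⟨ solve 4 (λ q m u v → (q :* m) :* (u :* v) := (u :* q) :* (v :* m)) refl q m u₁ u₂ ⟩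
      (u₁ * q) * (u₂ * m) ≤⟨ *-mono-≤ (*-pos 0<l₁ 0<m) (*-pos (Y.U-pos u₂∈U) 0<m) u₁q≤l₁m u₂m≤l₂r ⟩
      (l₁ * m) * (l₂ * r) ≡⟨ solve 4 (λ l k m r → (l :* m) :* (k :* r) := (l :* k) :* (m :* r)) refl l₁ l₂ m r ⟩
      (l₁ * l₂) * (m * r) ≤⟨ *-monoʳ-≤-nonNeg (m * r) {{nonNegative (<⇒≤ (*-pos 0<m (<-trans 0<m m<r)))}} (<⇒≤ l₁l₂<q) ⟩
      q * (m * r)         ≡⟨ *-assoc q m r ⟨
      (q * m) * r         ∎
      where open ≤-Reasoning
    decide : Dec (q ≤ l₁ * l₂) → q ∈ L′ ⊎ r ∈ U′
    decide (yes q≤l₁l₂) = inj₁ (l₁ , l₂ , (0<l₁ , l₁∈L) , (0<l₂ , l₂∈L) , q≤l₁l₂)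
    decide (no  q≰l₁l₂) =
      inj₂ (u₁ , u₂ , u₁∈U , u₂∈U , *-cancelˡ-≤ (*-pos 0<q 0<m) (bound (≰⇒> q≰l₁l₂)))

  loc : q < r → q ∈ L′ ⊎ r ∈ U′
  loc {q} {r} q<r = decide (0ℚ <? q)
    where
    decide : Dec (0ℚ < q) → q ∈ L′ ⊎ r ∈ U′
    decide (no 0≮q) =
      let l₁ , l₂ , ∈L₁ , ∈L₂ , 0≤l₁l₂ = 0∈L
      in inj₁ (l₁ , l₂ , ∈L₁ , ∈L₂ , ≤-trans (≮⇒≥ 0≮q) 0≤l₁l₂)
    decide (yes 0<q) =
      let m , q<m , m<r = <-dense q<r
          _ , _ , near₁ = X.approx-ratio 0<q q<m
          _ , _ , near₂ = Y.approx-ratio (<-trans 0<q q<m) m<r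
      in compare 0<q q<m m<r near₁ near₂

  product : ℝ
  product = record
    { L           = L′
    ; U           = U′
    ; L-inhabited = 0ℚ , 0∈L
    ; U-inhabited = inhabited
    ; L-closed    = λ { q<r (r , s , ∈L₁ , ∈L₂ , le) → r , s , ∈L₁ , ∈L₂ , ≤-trans (<⇒≤ q<r) le }
    ; U-closed    = λ { q<r (r , s , ∈U₁ , ∈U₂ , le) → r , s , ∈U₁ , ∈U₂ , ≤-trans le (<⇒≤ q<r) }
    ; L-open      = open-L
    ; U-open      = open-U
    ; disjoint    = disj
    ; located     = loc
    }

infixr 8 _^_

_^_ : ℝ⁺ → ℕ → ℝ⁺
x ^ zero  = 1⁺
x ^ suc k = x · x ^ k

-- The positive k-th root: a rational q > 0 lies below it iff q ^ k < x, and
-- above it iff x < q ^ k.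
root : (k : ℕ) .{{_ : ℕ.NonZero k}} → ℝ⁺ → ℝ⁺
root k x = kth-root ,⁺ 0∈L
  where
  module X = ℝ⁺ x

  L′ U′ : Pred ℚ 0ℓ
  L′ q = ∃ λ r → 0ℚ < r × r ^ℚ k ∈ X.L × q ≤ r
  U′ q = 0ℚ < q × q ^ℚ k ∈ X.U

  0∈L : 0ℚ ∈ L′
  0∈L with l , 0<l , l∈L ← X.L-pos
    with r , 0<r , r≤l , r≤1 ← smaller 0<l 0<1
    = r , 0<r , X.L-closed-≤ (≤-trans (^ℚ-≤ k 0<r r≤1) r≤l) l∈L , <⇒≤ 0<r

  inhabited : ∃ λ q → q ∈ U′
  inhabited with u , u∈U ← X.U-inhabited with ≤-total u 1ℚ
  ... | inj₁ u≤1 = 1ℚ , 0<1 , X.U-closed-≤ (≤-trans u≤1 (^ℚ-≥ k ≤-refl)) u∈U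
  ... | inj₂ 1≤u = u , <-≤-trans 0<1 1≤u , X.U-closed-≤ (^ℚ-≥ k 1≤u) u∈U

  open-L : q ∈ L′ → ∃ λ r → q < r × r ∈ L′
  open-L (r , 0<r , rᵏ∈L , q≤r)
    with s , rᵏ<s , s∈L ← X.L-open rᵏ∈L
    with r′ , r<r′ , r′ᵏ<s ← ^ℚ-enlarge k 0<r rᵏ<s
    = r′ , ≤-<-trans q≤r r<r′ , r′ , <-trans 0<r r<r′ , X.L-closed r′ᵏ<s s∈L , ≤-refl

  open-U : r ∈ U′ → ∃ λ q → q < r × q ∈ U′
  open-U (0<r , rᵏ∈U)
    with s , s<rᵏ , s∈U ← X.U-open rᵏ∈U
    with q , 0<q , q<r , s<qᵏ ← ^ℚ-shrink k (X.U-pos s∈U) 0<r s<rᵏ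
    = q , q<r , 0<q , X.U-closed s<qᵏ s∈U

  loc : q < r → q ∈ L′ ⊎ r ∈ U′
  loc {q} {r} q<r with 0ℚ <? q
  ... | no 0≮q with s , 0<s , sᵏ∈L , 0≤s ← 0∈L = inj₁ (s , 0<s , sᵏ∈L , ≤-trans (≮⇒≥ 0≮q) 0≤s)
  ... | yes 0<q with X.located (^ℚ-mono-< k 0<q q<r)
  ... | inj₁ qᵏ∈L = inj₁ (q , 0<q , qᵏ∈L , ≤-refl)
  ... | inj₂ rᵏ∈U = inj₂ (<-trans 0<q q<r , rᵏ∈U)

  kth-root : ℝ
  kth-root = record
    { L           = L′
    ; U           = U′
    ; L-inhabited = 0ℚ , 0∈L
    ; U-inhabited = inhabited
    ; L-closed    = λ { q<r (r , 0<r , rᵏ∈L , le) → r , 0<r , rᵏ∈L , ≤-trans (<⇒≤ q<r) le }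
    ; U-closed    = λ { q<r (0<q , qᵏ∈U) →
                        <-trans 0<q q<r , X.U-closed (^ℚ-mono-< k 0<q q<r) qᵏ∈U }
    ; L-open      = open-L
    ; U-open      = open-U
    ; disjoint    = λ { (r , 0<r , rᵏ∈L , q≤r) (0<q , qᵏ∈U) →
                        X.disjoint (X.L-closed-≤ (^ℚ-mono-≤ k 0<q q≤r) rᵏ∈L) qᵏ∈U }
    ; located     = loc
    }

∛_ : ℝ⁺ → ℝ⁺
∛ x = root 3 x

-- x ^3⁻ n is the fractional power of x with exponent 3⁻ⁿ.
infixl 8 _^3⁻_

_^3⁻_ : ℝ⁺ → ℕ → ℝ⁺
x ^3⁻ n = root (3 ℕ.^ n) {{m^n≢0 3 n}} x

-- g is the case of scaling constant 1: nothing multiplies the cube root.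
g : (a b c : ℝ⁺) → ℕ → ℝ⁺
g a b c 0                   = a
g a b c 1                   = b
g a b c 2                   = c
g a b c (suc (suc (suc n))) = ∛ (g a b c (suc (suc n)) · g a b c (suc n) · g a b c n)

-- All terms are nonnegative, so T is ℕ-valued and its terms can be exponents.
T : ℕ → ℕ
T 0                   = 0
T 1                   = 0
T 2                   = 1
T (suc (suc (suc n))) = T (suc (suc n)) ℕ.+ 3 ℕ.* T (suc n) ℕ.+ 9 ℕ.* T n

{-# OPTIONS --safe #-}
-- Raising the recurrence to the power 3ⁿ⁺¹ turns it into
--   g(n+3)^3ⁿ⁺¹ = g(n+2)^3ⁿ · (g(n+1)^3ⁿ⁻¹)³ · (g(n)^3ⁿ⁻²)⁹,
-- so the exponents of a, b and c in g(n+2)^3ⁿ obey the linear recurrence of T;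
-- this needs nothing but a commutative monoid.  Uniqueness of positive roots
-- then recovers g(n+2).
module Submission where

open import Defs
open import Algebra.Bundles using (CommutativeMonoid)
import Algebra.Definitions.RawMonoid as RawMonoidDefinitions
import Algebra.Properties.CommutativeMonoid.Mult as Mult
import Algebra.Properties.CommutativeSemigroup as CommutativeSemigroupProperties
import Algebra.Solver.CommutativeMonoid as MonoidSolver
open import Data.Nat.Base as ℕ using (ℕ; zero; suc; _+_; _*_)
import Data.Nat.Properties as ℕ
import Data.Nat.Tactic.RingSolver as ℕ-RingSolver
open import Data.Product.Base using (∃; _×_; _,_; proj₁; proj₂)
open import Data.Rational.Base as ℚ using (0ℚ; nonNegative)
import Data.Rational.Properties as ℚ
open import Data.Sum.Base using (inj₁; inj₂)
open import Level using (0ℓ) renaming (suc to lsuc)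
open import Relation.Binary.PropositionalEquality as ≡ using (_≡_; refl; cong; cong₂; subst)
import Relation.Binary.Reasoning.Setoid as SetoidReasoning
open import Relation.Nullary.Negation.Core using (contradiction)
open import Relation.Unary using (_∈_; _⊆_)

open ℝ⁺ using (L; U)

-- Exponents of the mean recurrence in a commutative monoid, written additively.

module MeanRecurrence {c ℓ} (M : CommutativeMonoid c ℓ) where

  open CommutativeMonoid M renaming (_≈_ to _∼_; refl to ∼-refl; _∙_ to _⊕_;
    ∙-cong to ⊕-cong; ∙-congʳ to ⊕-congʳ)
  open Mult M renaming (_×_ to _⊗_; ×-congʳ to ⊗-congʳ; ×-congˡ to ⊗-congˡ;
    ×-homo-+ to ⊗-homo-+; ×-assocˡ to ⊗-assocˡ; ×-distrib-+ to ⊗-distrib-⊕)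
  open CommutativeSemigroupProperties commutativeSemigroup using (interchange)
  open MonoidSolver M using (solve; id; _⊜_) renaming (_⊕_ to _⊞_)
  open SetoidReasoning setoid

  -- In the application `⊗` is taking powers, so this is the monomial with exponents `i`, `j`, `k`.
  combination : (x y z : Carrier) → ℕ → ℕ → ℕ → Carrier
  combination x y z i j k = i ⊗ x ⊕ j ⊗ y ⊕ k ⊗ z

  module _ (x y z : Carrier) where

    combination-⊕ : ∀ i j k i′ j′ k′ →
      combination x y z i j k ⊕ combination x y z i′ j′ k′ ∼
      combination x y z (i + i′) (j + j′) (k + k′)
    combination-⊕ i j k i′ j′ k′ = begin
      (i ⊗ x ⊕ j ⊗ y ⊕ k ⊗ z) ⊕ (i′ ⊗ x ⊕ j′ ⊗ y ⊕ k′ ⊗ z)    ≈⟨ interchange _ _ _ _ ⟩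
      (i ⊗ x ⊕ j ⊗ y) ⊕ (i′ ⊗ x ⊕ j′ ⊗ y) ⊕ (k ⊗ z ⊕ k′ ⊗ z)  ≈⟨ ⊕-congʳ (interchange _ _ _ _) ⟩
      (i ⊗ x ⊕ i′ ⊗ x) ⊕ (j ⊗ y ⊕ j′ ⊗ y) ⊕ (k ⊗ z ⊕ k′ ⊗ z)
        ≈⟨ ⊕-cong (⊕-cong (⊗-homo-+ x i i′) (⊗-homo-+ y j j′)) (⊗-homo-+ z k k′) ⟨
      (i + i′) ⊗ x ⊕ (j + j′) ⊗ y ⊕ (k + k′) ⊗ z              ∎

    ⊗-combination : ∀ m i j k →
      m ⊗ combination x y z i j k ∼ combination x y z (m * i) (m * j) (m * k)
    ⊗-combination m i j k = begin
      m ⊗ (i ⊗ x ⊕ j ⊗ y ⊕ k ⊗ z)              ≈⟨ ⊗-distrib-⊕ _ _ m ⟩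
      m ⊗ (i ⊗ x ⊕ j ⊗ y) ⊕ m ⊗ (k ⊗ z)        ≈⟨ ⊕-congʳ (⊗-distrib-⊕ _ _ m) ⟩
      m ⊗ (i ⊗ x) ⊕ m ⊗ (j ⊗ y) ⊕ m ⊗ (k ⊗ z)
        ≈⟨ ⊕-cong (⊕-cong (⊗-assocˡ x m i) (⊗-assocˡ y m j)) (⊗-assocˡ z m k) ⟩
      (m * i) ⊗ x ⊕ (m * j) ⊗ y ⊕ (m * k) ⊗ z  ∎

  module _ (G : ℕ → Carrier) (rec : ∀ n → 3 ⊗ G (3 + n) ∼ G (2 + n) ⊕ G (1 + n) ⊕ G n) where

    -- For `k` a power of 3, the factor `3 * k` is by computation the next power, the weight that
    -- `solution` puts on the next term.
    scaled-rec : ∀ k n →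
      (3 * k) ⊗ G (3 + n) ∼ k ⊗ G (2 + n) ⊕ k ⊗ G (1 + n) ⊕ k ⊗ G n
    scaled-rec k n = begin
      (3 * k) ⊗ G (3 + n)                        ≈⟨ ⊗-congˡ (ℕ.*-comm 3 k) ⟩
      (k * 3) ⊗ G (3 + n)                        ≈⟨ ⊗-assocˡ _ k 3 ⟨
      k ⊗ (3 ⊗ G (3 + n))                        ≈⟨ ⊗-congʳ k (rec n) ⟩
      k ⊗ (G (2 + n) ⊕ G (1 + n) ⊕ G n)          ≈⟨ ⊗-distrib-⊕ _ _ k ⟩
      k ⊗ (G (2 + n) ⊕ G (1 + n)) ⊕ k ⊗ G n      ≈⟨ ⊕-congʳ (⊗-distrib-⊕ _ _ k) ⟩
      k ⊗ G (2 + n) ⊕ k ⊗ G (1 + n) ⊕ k ⊗ G n    ∎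

    T-combination : ℕ → Carrier
    T-combination n =
      combination (G 0) (G 1) (G 2) (T (1 + n)) (T (1 + n) + 3 * T n) (T (2 + n))

    -- Each of the three exponents is a linear combination of shifts of `T`, so each inherits the
    -- linear recurrence of `T`.
    T-combination-rec : ∀ n →
      T-combination (2 + n) ⊕ 3 ⊗ T-combination (1 + n) ⊕ 9 ⊗ T-combination n ∼
      T-combination (3 + n)
    T-combination-rec n = begin
      T-combination (2 + n) ⊕ 3 ⊗ T-combination (1 + n) ⊕ 9 ⊗ T-combination n
        ≈⟨ ⊕-cong (⊕-cong ∼-refl (⊗-combination x y z 3 t₂ (t₂ + 3 * t₁) t₃))
                  (⊗-combination x y z 9 t₁ (t₁ + 3 * t₀) t₂) ⟩
      comb t₃ (t₃ + 3 * t₂) t₄ ⊕ comb (3 * t₂) (3 * (t₂ + 3 * t₁)) (3 * t₃)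
        ⊕ comb (9 * t₁) (9 * (t₁ + 3 * t₀)) (9 * t₂)
        ≈⟨ ⊕-congʳ (combination-⊕ x y z t₃ (t₃ + 3 * t₂) t₄ (3 * t₂) (3 * (t₂ + 3 * t₁)) (3 * t₃)) ⟩
      comb (t₃ + 3 * t₂) ((t₃ + 3 * t₂) + 3 * (t₂ + 3 * t₁)) (t₄ + 3 * t₃)
        ⊕ comb (9 * t₁) (9 * (t₁ + 3 * t₀)) (9 * t₂)
        ≈⟨ combination-⊕ x y z (t₃ + 3 * t₂) ((t₃ + 3 * t₂) + 3 * (t₂ + 3 * t₁)) (t₄ + 3 * t₃)
                               (9 * t₁) (9 * (t₁ + 3 * t₀)) (9 * t₂) ⟩
      comb (t₃ + 3 * t₂ + 9 * t₁)
           ((t₃ + 3 * t₂) + 3 * (t₂ + 3 * t₁) + 9 * (t₁ + 3 * t₀))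
           (t₄ + 3 * t₃ + 9 * t₂)
        -- The outer exponents are already `T (4 + n)` and `T (5 + n)` by the defining clause of
        -- `T`; only the middle one needs regrouping.
        ≈⟨ reflexive (cong (λ j → comb t₄ j (T (5 + n))) (middle t₀ t₁ t₂)) ⟩
      T-combination (3 + n) ∎
      where
      x y z : Carrier
      x = G 0
      y = G 1
      z = G 2
      comb : ℕ → ℕ → ℕ → Carrier
      comb = combination x y z
      t₀ t₁ t₂ t₃ t₄ : ℕ
      t₀ = T n
      t₁ = T (1 + n)
      t₂ = T (2 + n)
      t₃ = T (3 + n)
      t₄ = T (4 + n)
      -- The identity fails for an independent `t₃`, so `t₃` is expanded by the recurrence of `T`.
      middle : ∀ t₀ t₁ t₂ → let t₃ = t₂ + 3 * t₁ + 9 * t₀ in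
        (t₃ + 3 * t₂) + 3 * (t₂ + 3 * t₁) + 9 * (t₁ + 3 * t₀) ≡
        (t₃ + 3 * t₂ + 9 * t₁) + 3 * t₃
      middle = ℕ-RingSolver.solve-∀

    -- Induction reaching back three places, hence three base cases, each a comparison of explicit
    -- exponents: (0, 0, 1), (1, 1, 1) and (1, 4, 4).
    solution : ∀ n → (3 ℕ.^ n) ⊗ G (2 + n) ∼ T-combination n
    solution 0 =
      solve 1 (λ z → z ⊞ id ⊜ (id ⊞ id) ⊞ (z ⊞ id)) ∼-refl (G 2)
    solution 1 = trans (rec 0)
      (solve 3 (λ x y z → (z ⊞ y) ⊞ x ⊜ ((x ⊞ id) ⊞ (y ⊞ id)) ⊞ (z ⊞ id)) ∼-refl (G 0) (G 1) (G 2))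
    -- Of the three terms produced, only `G 3` is not an initial value; its factor 3 is exactly what
    -- `rec 0` absorbs.
    solution 2 = trans (scaled-rec 3 1) (trans (⊕-congʳ (⊕-congʳ (rec 0)))
      (solve 3 (λ x y z → let 3· = λ w → w ⊞ (w ⊞ (w ⊞ id)) in
          (((z ⊞ y) ⊞ x) ⊞ 3· z) ⊞ 3· y ⊜ ((x ⊞ id) ⊞ (y ⊞ 3· y)) ⊞ (z ⊞ 3· z))
        ∼-refl (G 0) (G 1) (G 2)))
    solution (suc (suc (suc n))) = begin
      (3 ℕ.^ (3 + n)) ⊗ G (5 + n)
        ≈⟨ scaled-rec (3 ℕ.^ (2 + n)) (2 + n) ⟩
      (3 ℕ.^ (2 + n)) ⊗ G (4 + n) ⊕ (3 ℕ.^ (2 + n)) ⊗ G (3 + n) ⊕ (3 ℕ.^ (2 + n)) ⊗ G (2 + n)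
        -- The common weight is 1, 3 and 9 times the weights in the three induction hypotheses,
        -- which is where the coefficients of `T` come from.
        ≈⟨ ⊕-cong (⊕-cong (solution (suc (suc n))) (multiple 3 (3 ℕ.^ (1 + n)) refl (solution (suc n))))
                  (multiple 9 (3 ℕ.^ n) (≡.sym (ℕ.*-assoc 3 3 (3 ℕ.^ n))) (solution n)) ⟩
      T-combination (2 + n) ⊕ 3 ⊗ T-combination (1 + n) ⊕ 9 ⊗ T-combination n
        ≈⟨ T-combination-rec n ⟩
      T-combination (3 + n) ∎
      where
      multiple : ∀ {l x y} m k → l ≡ m * k → k ⊗ x ∼ y → l ⊗ x ∼ m ⊗ y
      multiple m k refl kx∼y = trans (sym (⊗-assocˡ _ m k)) (⊗-congʳ m kx∼y)

-- Positive reals form a commutative monoid under multiplication.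

-- By locatedness the reverse inclusions come for free.
⊆⇒≈ : ∀ x y → L x ⊆ L y → U x ⊆ U y → x ≈ y
⊆⇒≈ x y L⊆ U⊆ q = (L⊆ , L⊇) , (U⊆ , U⊇)
  where
  L⊇ : q ∈ L y → q ∈ L x
  L⊇ q∈Ly with r , q<r , r∈Ly ← ℝ⁺.L-open y q∈Ly with ℝ⁺.located x q<r
  ... | inj₁ q∈Lx = q∈Lx
  ... | inj₂ r∈Ux = contradiction (U⊆ r∈Ux) (ℝ⁺.disjoint y r∈Ly)
  U⊇ : q ∈ U y → q ∈ U x
  U⊇ q∈Uy with p , p<q , p∈Uy ← ℝ⁺.U-open y q∈Uy with ℝ⁺.located x p<q
  ... | inj₁ p∈Lx = contradiction p∈Uy (ℝ⁺.disjoint y (L⊆ p∈Lx))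
  ... | inj₂ q∈Ux = q∈Ux

≈⇒L⊆ : ∀ x y → x ≈ y → L x ⊆ L y
≈⇒L⊆ x y x≈y {q} = proj₁ (proj₁ (x≈y q))

≈⇒U⊆ : ∀ x y → x ≈ y → U x ⊆ U y
≈⇒U⊆ x y x≈y {q} = proj₁ (proj₂ (x≈y q))

≈-refl : ∀ {x} → x ≈ x
≈-refl {x} = ⊆⇒≈ x x (λ q∈L → q∈L) (λ q∈U → q∈U)

≈-sym : ∀ {x y} → x ≈ y → y ≈ x
≈-sym x≈y q with (f , f′) , (h , h′) ← x≈y q = (f′ , f) , (h′ , h)

≈-trans : ∀ {x y z} → x ≈ y → y ≈ z → x ≈ z
≈-trans {x} {y} {z} x≈y y≈z = ⊆⇒≈ x z
  (λ q∈L → ≈⇒L⊆ y z y≈z (≈⇒L⊆ x y x≈y q∈L))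
  (λ q∈U → ≈⇒U⊆ y z y≈z (≈⇒U⊆ x y x≈y q∈U))

·-cong : ∀ {x x′ y y′} → x ≈ x′ → y ≈ y′ → x · y ≈ x′ · y′
·-cong {x} {x′} {y} {y′} x≈x′ y≈y′ = ⊆⇒≈ (x · y) (x′ · y′)
  (λ { (r , s , (0<r , r∈L) , (0<s , s∈L) , q≤rs) →
       r , s , (0<r , ≈⇒L⊆ x x′ x≈x′ r∈L) , (0<s , ≈⇒L⊆ y y′ y≈y′ s∈L) , q≤rs })
  (λ { (r , s , r∈U , s∈U , rs≤q) →
       r , s , ≈⇒U⊆ x x′ x≈x′ r∈U , ≈⇒U⊆ y y′ y≈y′ s∈U , rs≤q })

·-comm : ∀ x y → x · y ≈ y · x
·-comm x y = ⊆⇒≈ (x · y) (y · x)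
  (λ { {q} (r , s , r∈L , s∈L , q≤rs) → s , r , s∈L , r∈L , subst (q ℚ.≤_) (ℚ.*-comm r s) q≤rs })
  (λ { {q} (r , s , r∈U , s∈U , rs≤q) → s , r , s∈U , r∈U , subst (ℚ._≤ q) (ℚ.*-comm r s) rs≤q })

·-assoc : ∀ x y z → (x · y) · z ≈ x · (y · z)
·-assoc x y z = ⊆⇒≈ ((x · y) · z) (x · (y · z))
  (λ { {q} (p , t , (0<p , r , s , r∈L , (0<s , s∈L) , p≤rs) , (0<t , t∈L) , q≤pt) →
       r , s ℚ.* t , r∈L , (*-pos 0<s 0<t , s , t , (0<s , s∈L) , (0<t , t∈L) , ℚ.≤-refl) ,
       ℚ.≤-trans q≤pt (subst (p ℚ.* t ℚ.≤_) (ℚ.*-assoc r s t)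
         (ℚ.*-monoʳ-≤-nonNeg t {{nonNegative (ℚ.<⇒≤ 0<t)}} p≤rs)) })
  (λ { {q} (p , t , (r , s , r∈U , s∈U , rs≤p) , t∈U , pt≤q) →
       r , s ℚ.* t , r∈U , (s , t , s∈U , t∈U , ℚ.≤-refl) ,
       ℚ.≤-trans (subst (ℚ._≤ p ℚ.* t) (ℚ.*-assoc r s t)
         (ℚ.*-monoʳ-≤-nonNeg t {{nonNegative (ℚ.<⇒≤ (ℝ⁺.U-pos z t∈U))}} rs≤p)) pt≤q })

·-identityˡ : ∀ x → 1⁺ · x ≈ x
·-identityˡ x = ⊆⇒≈ (1⁺ · x) x
  (λ { {q} (r , s , (_ , r<1) , (0<s , s∈L) , q≤rs) → ℝ⁺.L-closed-≤ x
       (ℚ.≤-trans q≤rs (subst (r ℚ.* s ℚ.≤_) (ℚ.*-identityˡ s)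
         (ℚ.*-monoʳ-≤-nonNeg s {{nonNegative (ℚ.<⇒≤ 0<s)}} (ℚ.<⇒≤ r<1)))) s∈L })
  (λ { {q} (r , s , 1<r , s∈U , rs≤q) → ℝ⁺.U-closed-≤ x
       (ℚ.≤-trans (subst (ℚ._≤ r ℚ.* s) (ℚ.*-identityˡ s)
         (ℚ.*-monoʳ-≤-nonNeg s {{nonNegative (ℚ.<⇒≤ (ℝ⁺.U-pos x s∈U))}} (ℚ.<⇒≤ 1<r))) rs≤q) s∈U })

·-identityʳ : ∀ x → x · 1⁺ ≈ x
·-identityʳ x = ≈-trans {x · 1⁺} {1⁺ · x} {x} (·-comm x 1⁺) (·-identityˡ x)

·-commutativeMonoid : CommutativeMonoid (lsuc 0ℓ) 0ℓ
·-commutativeMonoid = record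
  { Carrier             = ℝ⁺
  ; _≈_                 = _≈_
  ; _∙_                 = _·_
  ; ε                   = 1⁺
  ; isCommutativeMonoid = record
    { isMonoid = record
      { isSemigroup = record
        { isMagma = record
          { isEquivalence = record
            { refl  = λ {x} → ≈-refl {x}
            ; sym   = λ {x} {y} → ≈-sym {x} {y}
            ; trans = λ {x} {y} {z} → ≈-trans {x} {y} {z}
            }
          ; ∙-cong = λ {x} {x′} {y} {y′} → ·-cong {x} {x′} {y} {y′}
          }
        ; assoc = ·-assoc
        }
      ; identity = ·-identityˡ , ·-identityʳ
      }
    ; comm = ·-comm
    }
  }

-- Bounds of powers, and existence and uniqueness of roots.

-- The induction starts at 1: cuts are open, so `q ^ℚ 0`, which is 1, is not a lower bound of `1⁺`.
-- The case 1 goes through the unit law instead.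
^-L⁺ : ∀ x k .{{_ : ℕ.NonZero k}} {q} → 0ℚ ℚ.< q → q ∈ L x → q ^ℚ k ∈ L (x ^ k)
^-L⁺ x 1 {q} 0<q q∈L =
  ≈⇒L⊆ x (x ^ 1) (≈-sym {x ^ 1} {x} (·-identityʳ x)) (subst (_∈ L x) (≡.sym (ℚ.*-identityʳ q)) q∈L)
^-L⁺ x (suc k@(suc _)) {q} 0<q q∈L =
  q , q ^ℚ k , (0<q , q∈L) , (^ℚ-pos k 0<q , ^-L⁺ x k 0<q q∈L) , ℚ.≤-refl

-- As for lower bounds, 1 is not an upper bound of `1⁺`, so exponent 0 is excluded.
^-U⁺ : ∀ x k .{{_ : ℕ.NonZero k}} {q} → q ∈ U x → q ^ℚ k ∈ U (x ^ k)
^-U⁺ x 1 {q} q∈U =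
  ≈⇒U⊆ x (x ^ 1) (≈-sym {x ^ 1} {x} (·-identityʳ x)) (subst (_∈ U x) (≡.sym (ℚ.*-identityʳ q)) q∈U)
^-U⁺ x (suc k@(suc _)) {q} q∈U = q , q ^ℚ k , q∈U , ^-U⁺ x k q∈U , ℚ.≤-refl

-- A lower bound of the power comes from a product of possibly different lower bounds of `x`; the
-- largest of them can replace all the others.
^-L⁻ : ∀ x k {q} → q ∈ L (x ^ k) → ∃ λ r → 0ℚ ℚ.< r × r ∈ L x × q ℚ.≤ r ^ℚ k
^-L⁻ x zero q<1 with r , 0<r , r∈L ← ℝ⁺.L-pos x = r , 0<r , r∈L , ℚ.<⇒≤ q<1
^-L⁻ x (suc k) (r , s , (0<r , r∈L) , (0<s , s∈L) , q≤rs)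
  with t , 0<t , t∈L , s≤tᵏ ← ^-L⁻ x k s∈L with ℚ.≤-total r t
... | inj₁ r≤t = t , 0<t , t∈L , ℚ.≤-trans q≤rs (*-mono-≤ 0<t 0<s r≤t s≤tᵏ)
... | inj₂ t≤r = r , 0<r , r∈L ,
  ℚ.≤-trans q≤rs (*-mono-≤ 0<r 0<s ℚ.≤-refl (ℚ.≤-trans s≤tᵏ (^ℚ-mono-≤ k 0<t t≤r)))

-- Dually, the smallest of the upper bounds of `x` in the product replaces the others.
^-U⁻ : ∀ x k {q} → q ∈ U (x ^ k) → ∃ λ r → r ∈ U x × r ^ℚ k ℚ.≤ q
^-U⁻ x zero 1<q with r , r∈U ← ℝ⁺.U-inhabited x = r , r∈U , ℚ.<⇒≤ 1<q
^-U⁻ x (suc k) (r , s , r∈U , s∈U , rs≤q)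
  with t , t∈U , tᵏ≤s ← ^-U⁻ x k s∈U with ℚ.≤-total r t
... | inj₁ r≤t = r , r∈U , ℚ.≤-trans (*-mono-≤ 0<r (^ℚ-pos k 0<r) ℚ.≤-refl
                   (ℚ.≤-trans (^ℚ-mono-≤ k 0<r r≤t) tᵏ≤s)) rs≤q
  where
  0<r : 0ℚ ℚ.< r
  0<r = ℝ⁺.U-pos x r∈U
... | inj₂ t≤r = t , t∈U ,
  ℚ.≤-trans (*-mono-≤ (ℝ⁺.U-pos x r∈U) (^ℚ-pos k (ℝ⁺.U-pos x t∈U)) t≤r tᵏ≤s) rs≤q

-- A bound of the power reduces to the `k`-th power of a single bound of the root, and the cut of
-- the root is defined by comparing such powers with `x`.
root-^ : ∀ k .{{_ : ℕ.NonZero k}} x → root k x ^ k ≈ x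
root-^ k x = ⊆⇒≈ (root k x ^ k) x below above
  where
  below : L (root k x ^ k) ⊆ L x
  below q∈L with r , 0<r , (s , _ , sᵏ∈L , r≤s) , q≤rᵏ ← ^-L⁻ (root k x) k q∈L
    = ℝ⁺.L-closed-≤ x (ℚ.≤-trans q≤rᵏ (^ℚ-mono-≤ k 0<r r≤s)) sᵏ∈L
  above : U (root k x ^ k) ⊆ U x
  above q∈U with r , (_ , rᵏ∈U) , rᵏ≤q ← ^-U⁻ (root k x) k q∈U = ℝ⁺.U-closed-≤ x rᵏ≤q rᵏ∈U

-- The `k`-th power of a positive bound of `y` bounds `y ^ k`, hence `x`, and this is the membership
-- condition of the root.
root-unique : ∀ k .{{_ : ℕ.NonZero k}} x y → y ^ k ≈ x → y ≈ root k x
root-unique k x y yᵏ≈x = ⊆⇒≈ y (root k x) below above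
  where
  below : L y ⊆ L (root k x)
  -- `q` may be negative or zero, while the lower cut of the root asks for a positive witness; the
  -- larger of `q` and a positive `r` serves.
  below {q} q∈L with r , 0<r , r∈L ← ℝ⁺.L-pos y with ℚ.≤-total q r
  ... | inj₁ q≤r = r , 0<r , ≈⇒L⊆ (y ^ k) x yᵏ≈x (^-L⁺ y k 0<r r∈L) , q≤r
  ... | inj₂ r≤q = q , 0<q , ≈⇒L⊆ (y ^ k) x yᵏ≈x (^-L⁺ y k 0<q q∈L) , ℚ.≤-refl
    where
    0<q : 0ℚ ℚ.< q
    0<q = ℚ.<-≤-trans 0<r r≤q
  above : U y ⊆ U (root k x)
  above q∈U = ℝ⁺.U-pos y q∈U , ≈⇒U⊆ (y ^ k) x yᵏ≈x (^-U⁺ y k q∈U)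

-- Transfer from monoid multiples to powers of positive reals.

open RawMonoidDefinitions (CommutativeMonoid.rawMonoid ·-commutativeMonoid)
  using () renaming (_×_ to _⊗_)

-- Both sides follow the same recursion on `k`, so the terms are equal outright and not only up to
-- `≈`.
⊗≡^ : ∀ k x → k ⊗ x ≡ x ^ k
⊗≡^ zero    x = refl
⊗≡^ (suc k) x = cong (x ·_) (⊗≡^ k x)

g-power : ∀ a b c n →
  g a b c (2 + n) ^ (3 ℕ.^ n) ≈ a ^ T (1 + n) · b ^ (T (1 + n) + 3 * T n) · c ^ T (2 + n)
g-power a b c n = ≡.subst₂ _≈_ (⊗≡^ (3 ℕ.^ n) (g a b c (2 + n)))
  (cong₂ _·_ (cong₂ _·_ (⊗≡^ (T (1 + n)) a) (⊗≡^ (T (1 + n) + 3 * T n) b)) (⊗≡^ (T (2 + n)) c))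
  (solution (g a b c) rec n)
  where
  open MeanRecurrence ·-commutativeMonoid
  rec : ∀ n → 3 ⊗ g a b c (3 + n) ≈ g a b c (2 + n) · g a b c (1 + n) · g a b c n
  -- For the literal 3, multiple and power coincide by computation, and `g a b c (3 + n)` unfolds to
  -- the cube root being cubed.
  rec n = root-^ 3 (g a b c (2 + n) · g a b c (1 + n) · g a b c n)

lemma2p2 : (a b c : ℝ⁺) (n : ℕ) →
    g a b c (n + 2) ≈ (a ^ T (n + 1) · b ^ (T (n + 1) + 3 * T n) · c ^ T (n + 2)) ^3⁻ n
-- `g` and `T` compute on `2 + n` and `1 + n`, whereas `n + 2` and `n + 1` are stuck on the variable
-- `n`.
lemma2p2 a b c n rewrite ℕ.+-comm n 2 | ℕ.+-comm n 1 =
  root-unique (3 ℕ.^ n) {{ℕ.m^n≢0 3 n}}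
    (a ^ T (1 + n) · b ^ (T (1 + n) + 3 * T n) · c ^ T (2 + n)) (g a b c (2 + n)) (g-power a b c n)
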